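{- Every skewly representable function $f:\mathbb{N}^k\to\mathbb{N}$ with finite range is strictly representable.
   Context: We work in the simply typed $\lambda$-calculus (type assignment to untyped $\lambda$-terms) with a single base type $o$, with $\beta\eta$-conversion as equality. For a type $\tau$, $\omega_\tau=(\tau\to\tau)\to\tau\to\tau$. The Church numeral of $n$ is $\rho(n)=\lambda f x.f^{n}x$; every type assignable to all Church numerals is of the form $\omega_\tau$. A function $f:\mathbb{N}^k\to\mathbb{N}$ is skewly representable if there exist a term $E$ and types $\alpha_1,\dots,\alpha_k,\beta$ (each a type of Church numerals) with $\vdash E:\alpha_1\to\cdots\to\alpha_k\to\beta$ such that $E\,\rho(n_1)\cdots\rho(n_k)=_{\beta\eta}\rho(f(n_1,\dots,n_k))$ for all $n_1,\dots,n_k$, where $\rho(n_i)$ is typed with $\alpha_i$. It is strictly representable if this holds with $\alpha_1=\cdots=\alpha_k=\beta=\omega_\tau$ for some type $\tau$. -}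

module Defs where

open import Data.Fin.Base using (Fin; zero; suc)
open import Data.List.Base using (List)
open import Data.List.Membership.Propositional using (_∈_)
open import Data.Nat.Base using (ℕ; zero; suc)
open import Data.Nat.GeneralisedArithmetic using (fold)
open import Data.Product.Base using (Σ-syntax; ∃-syntax; _×_)
open import Data.Vec.Base using (Vec; []; _∷_; lookup; map; replicate)
open import Data.Vec.Relation.Unary.All using (All)
open import Relation.Binary.Construct.Closure.Equivalence using (EqClosure)

infixr 7 _⇒_ _⇛_
infixl 8 _·_ _·*_
infix  4 _⊢_∶_ _⟶_ _≈βη_

data Ty : Set where
  o   : Ty
  _⇒_ : Ty → Ty → Ty

-- Untyped λ-terms with free de Bruijn indices in Fin n.
data Term (n : ℕ) : Set where
  var : Fin n → Term n
  ƛ   : Term (suc n) → Term n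
  _·_ : Term n → Term n → Term n

extʳ : ∀ {m n} → (Fin m → Fin n) → Fin (suc m) → Fin (suc n)
extʳ r zero    = zero
extʳ r (suc i) = suc (r i)

rename : ∀ {m n} → (Fin m → Fin n) → Term m → Term n
rename r (var i) = var (r i)
rename r (ƛ t)   = ƛ (rename (extʳ r) t)
rename r (t · u) = rename r t · rename r u

extˢ : ∀ {m n} → (Fin m → Term n) → Fin (suc m) → Term (suc n)
extˢ s zero    = var zero
extˢ s (suc i) = rename suc (s i)

subst : ∀ {m n} → (Fin m → Term n) → Term m → Term n
subst s (var i) = s i
subst s (ƛ t)   = ƛ (subst (extˢ s) t)
subst s (t · u) = subst s t · subst s u

_[_] : ∀ {n} → Term (suc n) → Term n → Term n
_[_] {n} t u = subst s t
  where
  s : Fin (suc n) → Term n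
  s zero    = u
  s (suc i) = var i

data _⟶_ {n : ℕ} : Term n → Term n → Set where
  β-red : ∀ {t u} → ƛ t · u ⟶ t [ u ]
  η-red : ∀ {t} → ƛ (rename suc t · var zero) ⟶ t
  ξ     : ∀ {t t′} → t ⟶ t′ → ƛ t ⟶ ƛ t′
  ·ˡ    : ∀ {t t′ u} → t ⟶ t′ → t · u ⟶ t′ · u
  ·ʳ    : ∀ {t u u′} → u ⟶ u′ → t · u ⟶ t · u′

-- Conversion is that of the untyped calculus: intermediate terms need not be
-- typable.
_≈βη_ : ∀ {n} → Term n → Term n → Set
_≈βη_ = EqClosure _⟶_

data _⊢_∶_ {n : ℕ} (Γ : Vec Ty n) : Term n → Ty → Set where
  ⊢var : ∀ i → Γ ⊢ var i ∶ lookup Γ i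
  ⊢ƛ   : ∀ {t σ τ} → σ ∷ Γ ⊢ t ∶ τ → Γ ⊢ ƛ t ∶ σ ⇒ τ
  ⊢·   : ∀ {t u σ τ} → Γ ⊢ t ∶ σ ⇒ τ → Γ ⊢ u ∶ σ → Γ ⊢ t · u ∶ τ

_⇛_ : ∀ {k} → Vec Ty k → Ty → Ty
[]       ⇛ τ = τ
(σ ∷ σs) ⇛ τ = σ ⇒ (σs ⇛ τ)

_·*_ : ∀ {n k} → Term n → Vec (Term n) k → Term n
t ·* []       = t
t ·* (u ∷ us) = (t · u) ·* us

ω : Ty → Ty
ω τ = (τ ⇒ τ) ⇒ (τ ⇒ τ)

-- λ f x. fⁿ x
ρ : ℕ → Term 0
ρ n = ƛ (ƛ (fold (var zero) (var (suc zero) ·_) n))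

IsNumeralType : Ty → Set
IsNumeralType α = ∀ n → [] ⊢ ρ n ∶ α

Represents : ∀ {k} → Term 0 → (Vec ℕ k → ℕ) → Set
Represents E f = ∀ ns → E ·* map ρ ns ≈βη ρ (f ns)

SkewlyRepresentable : ∀ {k} → (Vec ℕ k → ℕ) → Set
SkewlyRepresentable {k} f =
  ∃[ E ] Σ[ αs ∈ Vec Ty k ] ∃[ β ]
    All IsNumeralType αs × IsNumeralType β ×
    [] ⊢ E ∶ αs ⇛ β × Represents E f

StrictlyRepresentable : ∀ {k} → (Vec ℕ k → ℕ) → Set
StrictlyRepresentable {k} f =
  ∃[ E ] ∃[ τ ] [] ⊢ E ∶ replicate k (ω τ) ⇛ ω τ × Represents E f

-- The list may contain values that f does not attain, so that attainment need
-- not be decided; classically this is finiteness of the range.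
FiniteRange : ∀ {k} → (Vec ℕ k → ℕ) → Set
FiniteRange f = Σ[ xs ∈ List ℕ ] (∀ ns → f ns ∈ xs)

{-# OPTIONS --safe #-}

-- With S = [o := π], the term E has type ω (S α₁) → … → ω (S αₖ) → ω (S β); conversion
-- does not see types.  Order types by sublist inclusion of their argument lists.
-- If α ⊑ τ then, given any element of α, α is a retract of τ, which gives a
-- coercion ω τ → ω α fixing all numerals; so the arguments of E can be read at a
-- common upper bound τ.  Iterating the predecessor ω ((π → π) → π) → ω π and
-- testing for zero gives, for suitable π, a term ω π → ω τ that fixes the numerals
-- up to M, for τ arbitrary; and π ⊑ S β.
module Submission where

open import Defs
open import Data.Fin.Base using (Fin; zero; suc)
open import Data.List.Extrema.Nat using (max; xs≤max)
import Data.List.Relation.Unary.All as ListAll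
open import Data.Nat.Base using (ℕ; zero; suc; _≤_; z≤n; s≤s)
open import Data.Nat.GeneralisedArithmetic using (fold)
open import Data.Product.Base using (∃-syntax; _,_)
open import Data.Vec.Base using (Vec; []; _∷_; lookup; map; replicate)
open import Data.Vec.Properties using (lookup-map)
open import Data.Vec.Relation.Unary.All using (All; []; _∷_)
import Data.Vec.Relation.Unary.All as VecAll
open import Function.Base using (_∘_)
open import Relation.Binary.Bundles using (Setoid)
open import Relation.Binary.Construct.Closure.Equivalence using (gmap; return; setoid)
open import Relation.Binary.PropositionalEquality using (_≡_; refl; sym; trans; cong; cong₂)
import Relation.Binary.PropositionalEquality as ≡
import Relation.Binary.Reasoning.Setoid as SetoidReasoning

private
  variable
    k l m n : ℕ
    α β σ τ π : Ty

-- Substitution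

rename-cong : {r r′ : Fin m → Fin n} → (∀ i → r i ≡ r′ i) → ∀ t → rename r t ≡ rename r′ t
rename-cong eq (var i) = cong var (eq i)
rename-cong eq (ƛ t)   = cong ƛ (rename-cong (λ { zero → refl ; (suc i) → cong suc (eq i) }) t)
rename-cong eq (t · u) = cong₂ _·_ (rename-cong eq t) (rename-cong eq u)

subst-cong : {s s′ : Fin m → Term n} → (∀ i → s i ≡ s′ i) → ∀ t → subst s t ≡ subst s′ t
subst-cong eq (var i) = eq i
subst-cong eq (ƛ t)   = cong ƛ (subst-cong (λ { zero → refl ; (suc i) → cong (rename suc) (eq i) }) t)
subst-cong eq (t · u) = cong₂ _·_ (subst-cong eq t) (subst-cong eq u)

rename-rename : (r′ : Fin m → Fin n) (r : Fin l → Fin m) → ∀ t → rename r′ (rename r t) ≡ rename (r′ ∘ r) t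
rename-rename r′ r (var i) = refl
rename-rename r′ r (ƛ t)   = cong ƛ (trans (rename-rename (extʳ r′) (extʳ r) t)
  (rename-cong (λ { zero → refl ; (suc i) → refl }) t))
rename-rename r′ r (t · u) = cong₂ _·_ (rename-rename r′ r t) (rename-rename r′ r u)

rename-subst : (r : Fin m → Fin n) (s : Fin l → Term m) → ∀ t → rename r (subst s t) ≡ subst (rename r ∘ s) t
rename-subst r s (var i) = refl
rename-subst r s (ƛ t)   = cong ƛ (trans (rename-subst (extʳ r) (extˢ s) t) (subst-cong ext-eq t))
  where
  ext-eq : ∀ i → rename (extʳ r) (extˢ s i) ≡ extˢ (rename r ∘ s) i
  ext-eq zero    = refl
  ext-eq (suc i) = trans (rename-rename (extʳ r) suc (s i)) (sym (rename-rename suc r (s i)))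
rename-subst r s (t · u) = cong₂ _·_ (rename-subst r s t) (rename-subst r s u)

subst-rename : (s : Fin m → Term n) (r : Fin l → Fin m) → ∀ t → subst s (rename r t) ≡ subst (s ∘ r) t
subst-rename s r (var i) = refl
subst-rename s r (ƛ t)   = cong ƛ (trans (subst-rename (extˢ s) (extʳ r) t)
  (subst-cong (λ { zero → refl ; (suc i) → refl }) t))
subst-rename s r (t · u) = cong₂ _·_ (subst-rename s r t) (subst-rename s r u)

subst-subst : (s′ : Fin m → Term n) (s : Fin l → Term m) → ∀ t → subst s′ (subst s t) ≡ subst (subst s′ ∘ s) t
subst-subst s′ s (var i) = refl
subst-subst s′ s (ƛ t)   = cong ƛ (trans (subst-subst (extˢ s′) (extˢ s) t) (subst-cong ext-eq t))
  where
  ext-eq : ∀ i → subst (extˢ s′) (extˢ s i) ≡ extˢ (subst s′ ∘ s) i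
  ext-eq zero    = refl
  ext-eq (suc i) = trans (subst-rename (extˢ s′) suc (s i)) (sym (rename-subst suc s′ (s i)))
subst-subst s′ s (t · u) = cong₂ _·_ (subst-subst s′ s t) (subst-subst s′ s u)

subst-id : {s : Fin n → Term n} → (∀ i → s i ≡ var i) → ∀ t → subst s t ≡ t
subst-id eq (var i) = eq i
subst-id eq (ƛ t)   = cong ƛ (subst-id (λ { zero → refl ; (suc i) → cong (rename suc) (eq i) }) t)
subst-id eq (t · u) = cong₂ _·_ (subst-id eq t) (subst-id eq u)

-- Weakening as substitution by the empty environment: it commutes with application by computation
-- and starts the induction in `β*`.
⌈_⌉ : Term 0 → Term n
⌈ t ⌉ = subst (lookup []) t

⌈⌉-id : ∀ t → ⌈ t ⌉ ≡ t
⌈⌉-id = subst-id (λ ())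

rename-⌈⌉ : (r : Fin m → Fin n) → ∀ t → rename r ⌈ t ⌉ ≡ ⌈ t ⌉
rename-⌈⌉ r t = trans (rename-subst r _ t) (subst-cong (λ ()) t)

-- Conversion

module _ {n : ℕ} where
  open Setoid (setoid (_⟶_ {n})) public using ()
    renaming (refl to ≈-refl; sym to ≈-sym; trans to ≈-trans; reflexive to ≈-reflexive)
  open SetoidReasoning (setoid (_⟶_ {n})) public

·-congˡ : {t t′ u : Term n} → t ≈βη t′ → t · u ≈βη t′ · u
·-congˡ = gmap (_· _) ·ˡ

·-congʳ : {t u u′ : Term n} → u ≈βη u′ → t · u ≈βη t · u′
·-congʳ = gmap (_ ·_) ·ʳ

·*-congˡ : {t t′ : Term n} (us : Vec (Term n) k) → t ≈βη t′ → t ·* us ≈βη t′ ·* us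
·*-congˡ []       p = p
·*-congˡ (u ∷ us) p = ·*-congˡ us (·-congˡ p)

extensionality : {t u : Term n} → rename suc t · var zero ≈βη rename suc u · var zero → t ≈βη u
extensionality p = ≈-trans (≈-sym (return η-red)) (≈-trans (gmap ƛ ξ p) (return η-red))

β-subst : (t : Term (suc m)) (us : Vec (Term n) m) (u : Term n) →
          subst (lookup us) (ƛ t) · u ≈βη subst (lookup (u ∷ us)) t
β-subst t us u = ≈-trans (return β-red) (≈-reflexive (trans (subst-subst _ _ t) (subst-cong
  (λ { zero → refl ; (suc i) → trans (subst-rename _ suc (lookup us i)) (subst-id (λ _ → refl) (lookup us i)) }) t)))

-- Closed terms built earlier are passed to a `ƛ*` as its leading arguments. This avoids weakening
-- them under binders, and one `β*` unfolds the whole definition.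
ƛ* : ∀ k → Term k → Term 0
ƛ* zero    t = t
ƛ* (suc k) t = ƛ* k (ƛ t)

-- Arguments are listed last first, so that positions agree with de Bruijn indices.
_·ᵛ_ : Term n → Vec (Term n) k → Term n
t ·ᵛ []       = t
t ·ᵛ (u ∷ us) = (t ·ᵛ us) · u

β* : (t : Term k) (us : Vec (Term n) k) → ⌈ ƛ* k t ⌉ ·ᵛ us ≈βη subst (lookup us) t
β* t []       = ≈-refl
β* t (u ∷ us) = ≈-trans (·-congˡ (β* (ƛ t) us)) (β-subst t us u)

pattern v0 = var zero
pattern v1 = var (suc zero)
pattern v2 = var (suc (suc zero))
pattern v3 = var (suc (suc (suc zero)))
pattern v4 = var (suc (suc (suc (suc zero))))
pattern v5 = var (suc (suc (suc (suc (suc zero)))))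
pattern v6 = var (suc (suc (suc (suc (suc (suc zero))))))

ρ-β : ∀ m (f x : Term n) → ⌈ ρ m ⌉ · f · x ≈βη fold x (f ·_) m
ρ-β m f x = ≈-trans (β* (fold v0 (v1 ·_) m) (x ∷ f ∷ [])) (≈-reflexive (subst-fold m))
  where
  subst-fold : ∀ m → subst (lookup (x ∷ f ∷ [])) (fold v0 (v1 ·_) m) ≡ fold x (f ·_) m
  subst-fold zero    = refl
  subst-fold (suc m) = cong (f ·_) (subst-fold m)

-- Two η-expansions reduce the claim to fresh variables for `f` and `x`. These live in a larger
-- context, hence a hypothesis over all contexts.
ρ-extensionality : ∀ (t : Term 0) l m →
  (∀ {n} (f x : Term n) → ⌈ t ⌉ · ⌈ ρ l ⌉ · f · x ≈βη fold x (f ·_) m) →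
  ∀ {n} → ⌈ t ⌉ · ⌈ ρ l ⌉ ≈βη ⌈_⌉ {n} (ρ m)
ρ-extensionality t l m p = extensionality (extensionality (begin
  wk² ⌈ t ⌉ · wk² ⌈ ρ l ⌉ · v1 · v0  ≡⟨ cong₂ (λ a b → a · b · v1 · v0) (wk²-⌈⌉ t) (wk²-⌈⌉ (ρ l)) ⟩
  ⌈ t ⌉ · ⌈ ρ l ⌉ · v1 · v0          ≈⟨ p v1 v0 ⟩
  fold v0 (v1 ·_) m                  ≈⟨ ρ-β m v1 v0 ⟨
  ⌈ ρ m ⌉ · v1 · v0                  ≡⟨ cong (λ a → a · v1 · v0) (wk²-⌈⌉ (ρ m)) ⟨
  wk² ⌈ ρ m ⌉ · v1 · v0              ∎))
  where
  wk² : Term n → Term (suc (suc n))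
  wk² t = rename suc (rename suc t)
  wk²-⌈⌉ : ∀ t → wk² (⌈_⌉ {n} t) ≡ ⌈ t ⌉
  wk²-⌈⌉ t = trans (cong (rename suc) (rename-⌈⌉ suc t)) (rename-⌈⌉ suc t)

-- Retractions

𝐊 : Term n
𝐊 = ƛ (ƛ v1)

𝐊-β : (t u : Term n) → 𝐊 · t · u ≈βη t
𝐊-β t u = β* v1 (u ∷ t ∷ [])

const-extensionality : (t u : Term n) → (∀ x → rename suc t · x ≈βη rename suc u) → t ≈βη 𝐊 · u
const-extensionality t u p = extensionality (≈-trans (p v0) (≈-sym (𝐊-β (rename suc u) v0)))

infix 4 _⊑_

data _⊑_ : Ty → Ty → Set where
  base : o ⊑ o
  keep : ∀ σ → α ⊑ τ → σ ⇒ α ⊑ σ ⇒ τ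
  drop : ∀ σ → α ⊑ τ → α ⊑ σ ⇒ τ

⊑-refl : ∀ α → α ⊑ α
⊑-refl o       = base
⊑-refl (σ ⇒ α) = keep σ (⊑-refl α)

o⊑ : ∀ α → o ⊑ α
o⊑ o       = base
o⊑ (σ ⇒ α) = drop σ (o⊑ α)

_⊔_ : Ty → Ty → Ty
o       ⊔ τ = τ
(σ ⇒ α) ⊔ τ = σ ⇒ (α ⊔ τ)

⊑-⊔ˡ : ∀ α τ → α ⊑ α ⊔ τ
⊑-⊔ˡ o       τ = o⊑ τ
⊑-⊔ˡ (σ ⇒ α) τ = keep σ (⊑-⊔ˡ α τ)

⊑-⊔ʳ : ∀ α → β ⊑ τ → β ⊑ α ⊔ τ
⊑-⊔ʳ o       p = p
⊑-⊔ʳ (σ ⇒ α) p = drop σ (⊑-⊔ʳ α p)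

upper-bound : (αs : Vec Ty k) → ∃[ τ ] All (_⊑ τ) αs
upper-bound []       = o , []
upper-bound (α ∷ αs) with upper-bound αs
... | τ , αs⊑τ = α ⊔ τ , ⊑-⊔ˡ α τ ∷ VecAll.map (⊑-⊔ʳ α) αs⊑τ

-- A type may lack closed elements, but an element of `o` always yields one, the function constantly
-- returning it. This fills the places of dropped arguments.
point : Ty → Term 0
point o       = ƛ v0
point (σ ⇒ α) = ƛ* 3 (v2 · v1) · point α

⊢point : ∀ α → [] ⊢ point α ∶ o ⇒ α
⊢point o       = ⊢ƛ (⊢var _)
⊢point (σ ⇒ α) = ⊢· (⊢ƛ (⊢ƛ (⊢ƛ (⊢· (⊢var _) (⊢var _))))) (⊢point α)

up : α ⊑ τ → Term 0
up base       = ƛ v0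
up (keep σ p) = ƛ* 3 (v2 · (v1 · v0)) · up p
up (drop σ p) = ƛ* 3 (v2 · v1) · up p

⊢up : (p : α ⊑ τ) → [] ⊢ up p ∶ α ⇒ τ
⊢up base       = ⊢ƛ (⊢var _)
⊢up (keep σ p) = ⊢· (⊢ƛ (⊢ƛ (⊢ƛ (⊢· (⊢var _) (⊢· (⊢var _) (⊢var _)))))) (⊢up p)
⊢up (drop σ p) = ⊢· (⊢ƛ (⊢ƛ (⊢ƛ (⊢· (⊢var _) (⊢var _))))) (⊢up p)

-- A dropped argument has to be supplied, possibly at an uninhabited type.  Hence
-- the element of τ is taken as a function of an element of o, and the latter is
-- obtained by applying the given element of α to all the arguments kept.
down : α ⊑ τ → Term 0
down base       = ƛ* 2 (v0 · v1)
down (keep σ p) = ƛ* 4 (v3 · (v2 · v0) · (ƛ (ƛ (ƛ (v2 · v0 · v1))) · v1 · v0)) · down p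
down (drop σ p) = ƛ* 4 (v3 · v1 · (ƛ (ƛ (ƛ (v2 · v0 · (v1 · v0)))) · v0 · v2)) · down p · point σ

⊢down : (p : α ⊑ τ) → [] ⊢ down p ∶ α ⇒ (o ⇒ τ) ⇒ α
⊢down base       = ⊢ƛ (⊢ƛ (⊢· (⊢var _) (⊢var _)))
⊢down (keep σ p) = ⊢· (⊢ƛ (⊢ƛ (⊢ƛ (⊢ƛ (⊢· (⊢· (⊢var _) (⊢· (⊢var _) (⊢var _)))
  (⊢· (⊢· (⊢ƛ (⊢ƛ (⊢ƛ (⊢· (⊢· (⊢var _) (⊢var _)) (⊢var _))))) (⊢var _)) (⊢var _))))))) (⊢down p)
⊢down (drop σ p) = ⊢· (⊢· (⊢ƛ (⊢ƛ (⊢ƛ (⊢ƛ (⊢· (⊢· (⊢var _) (⊢var _))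
  (⊢· (⊢· (⊢ƛ (⊢ƛ (⊢ƛ (⊢· (⊢· (⊢var _) (⊢var _)) (⊢· (⊢var _) (⊢var _)))))) (⊢var _)) (⊢var _))))))) (⊢down p)) (⊢point σ)

-- A constant function does not see the element of `o` extracted from `x`, so `x` cancels. The
-- inductive cases show that the function passed to the recursive call is again constant.
down-up : (p : α ⊑ τ) (x y : Term n) → ⌈ down p ⌉ · x · (𝐊 · (⌈ up p ⌉ · y)) ≈βη y
down-up base x y = begin
  ⌈ down base ⌉ · x · (𝐊 · (⌈ up base ⌉ · y))  ≈⟨ β* (v0 · v1) (_ ∷ x ∷ []) ⟩
  𝐊 · (⌈ up base ⌉ · y) · x                    ≈⟨ 𝐊-β _ x ⟩
  ⌈ up base ⌉ · y                              ≈⟨ β* v0 (y ∷ []) ⟩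
  y                                            ∎
down-up (keep σ p) x y = extensionality (begin
  rename suc (⌈ down (keep σ p) ⌉ · x · (𝐊 · (⌈ up (keep σ p) ⌉ · y))) · v0
    ≡⟨ cong₂ (λ a b → a · x′ · (𝐊 · (b · y′)) · v0) (rename-⌈⌉ suc (down (keep σ p))) (rename-⌈⌉ suc (up (keep σ p))) ⟩
  ⌈ down (keep σ p) ⌉ · x′ · (𝐊 · (⌈ up (keep σ p) ⌉ · y′)) · v0
    ≈⟨ β* (v3 · (v2 · v0) · (ƛ (ƛ (ƛ (v2 · v0 · v1))) · v1 · v0)) (v0 ∷ _ ∷ x′ ∷ _ ∷ []) ⟩
  ⌈ down p ⌉ · (x′ · v0) · (ƛ (ƛ (ƛ (v2 · v0 · v1))) · (𝐊 · (⌈ up (keep σ p) ⌉ · y′)) · v0)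
    ≈⟨ ·-congʳ (const-extensionality _ _ λ d → ≈-trans (β* (v2 · v0 · v1) (d ∷ _ ∷ _ ∷ [])) (·-congˡ (𝐊-β _ d))) ⟩
  ⌈ down p ⌉ · (x′ · v0) · (𝐊 · (⌈ up (keep σ p) ⌉ · y′ · v0))
    ≈⟨ ·-congʳ (·-congʳ (β* (v2 · (v1 · v0)) (v0 ∷ y′ ∷ _ ∷ []))) ⟩
  ⌈ down p ⌉ · (x′ · v0) · (𝐊 · (⌈ up p ⌉ · (y′ · v0)))
    ≈⟨ down-up p (x′ · v0) (y′ · v0) ⟩
  y′ · v0
    ∎)
  where
  x′ = rename suc x
  y′ = rename suc y
down-up (drop σ p) x y = begin
  ⌈ down (drop σ p) ⌉ · x · (𝐊 · (⌈ up (drop σ p) ⌉ · y))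
    ≈⟨ β* (v3 · v1 · (ƛ (ƛ (ƛ (v2 · v0 · (v1 · v0)))) · v0 · v2)) (_ ∷ x ∷ _ ∷ _ ∷ []) ⟩
  ⌈ down p ⌉ · x · (ƛ (ƛ (ƛ (v2 · v0 · (v1 · v0)))) · (𝐊 · (⌈ up (drop σ p) ⌉ · y)) · ⌈ point σ ⌉)
    ≈⟨ ·-congʳ (const-extensionality _ _ λ d → begin
         rename suc (ƛ (ƛ (ƛ (v2 · v0 · (v1 · v0)))) · (𝐊 · (⌈ up (drop σ p) ⌉ · y)) · ⌈ point σ ⌉) · d
           ≈⟨ β* (v2 · v0 · (v1 · v0)) (d ∷ _ ∷ _ ∷ []) ⟩
         𝐊 · rename suc (⌈ up (drop σ p) ⌉ · y) · d · (rename suc ⌈ point σ ⌉ · d)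
           ≈⟨ ·-congˡ (𝐊-β _ d) ⟩
         rename suc (⌈ up (drop σ p) ⌉ · y) · (rename suc ⌈ point σ ⌉ · d)
           ≡⟨ cong (λ a → a · rename suc y · (rename suc ⌈ point σ ⌉ · d)) (rename-⌈⌉ suc (up (drop σ p))) ⟩
         ⌈ up (drop σ p) ⌉ · rename suc y · (rename suc ⌈ point σ ⌉ · d)
           -- `up` ignores the argument of the dropped type, so the filler made by `point`
           -- disappears.
           ≈⟨ β* (v2 · v1) (_ ∷ _ ∷ _ ∷ []) ⟩
         ⌈ up p ⌉ · rename suc y
           ≡⟨ cong (_· rename suc y) (rename-⌈⌉ suc (up p)) ⟨
         rename suc (⌈ up p ⌉ · y) ∎) ⟩
  ⌈ down p ⌉ · x · (𝐊 · (⌈ up p ⌉ · y))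
    ≈⟨ down-up p x y ⟩
  y ∎

-- Coercions between numeral types

retract : α ⊑ τ → Term 0
retract p = ƛ* 3 (v2 · v1 · (𝐊 · v0)) · down p

⊢retract : (p : α ⊑ τ) → [] ⊢ retract p ∶ α ⇒ τ ⇒ α
⊢retract p = ⊢· (⊢ƛ (⊢ƛ (⊢ƛ (⊢· (⊢· (⊢var _) (⊢var _)) (⊢· (⊢ƛ (⊢ƛ (⊢var _))) (⊢var _)))))) (⊢down p)

retract-up : (p : α ⊑ τ) (x y : Term n) → ⌈ retract p ⌉ · x · (⌈ up p ⌉ · y) ≈βη y
retract-up p x y = ≈-trans (β* (v2 · v1 · (𝐊 · v0)) (_ ∷ x ∷ _ ∷ [])) (down-up p x y)

conjugate : α ⊑ τ → Term 0
conjugate p = ƛ* 5 (v4 · (v2 · (v3 · v1 · v0))) · up p · retract p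

⊢conjugate : (p : α ⊑ τ) → [] ⊢ conjugate p ∶ (α ⇒ α) ⇒ α ⇒ τ ⇒ τ
⊢conjugate p = ⊢· (⊢· (⊢ƛ (⊢ƛ (⊢ƛ (⊢ƛ (⊢ƛ (⊢· (⊢var _) (⊢· (⊢var _) (⊢· (⊢· (⊢var _) (⊢var _)) (⊢var _)))))))))
  (⊢up p)) (⊢retract p)

conjugate-up : (p : α ⊑ τ) (f x y : Term n) → ⌈ conjugate p ⌉ · f · x · (⌈ up p ⌉ · y) ≈βη ⌈ up p ⌉ · (f · y)
conjugate-up p f x y = ≈-trans (β* (v4 · (v2 · (v3 · v1 · v0))) (_ ∷ x ∷ f ∷ _ ∷ _ ∷ []))
  (·-congʳ (·-congʳ (retract-up p x y)))

-- The numeral at `τ` iterates the conjugate of `f` from the image of `x`, and the result is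
-- retracted. The element of `α` that the retraction asks for is `x` itself.
coerce : α ⊑ τ → Term 0
coerce p = ƛ* 6 (v4 · v0 · (v2 · (v3 · v1 · v0) · (v5 · v0))) · up p · retract p · conjugate p

⊢coerce : (p : α ⊑ τ) → [] ⊢ coerce p ∶ ω τ ⇒ ω α
⊢coerce p = ⊢· (⊢· (⊢· (⊢ƛ (⊢ƛ (⊢ƛ (⊢ƛ (⊢ƛ (⊢ƛ (⊢· (⊢· (⊢var _) (⊢var _))
  (⊢· (⊢· (⊢var _) (⊢· (⊢· (⊢var _) (⊢var _)) (⊢var _))) (⊢· (⊢var _) (⊢var _)))))))))) (⊢up p)) (⊢retract p)) (⊢conjugate p)

coerce-ρ : (p : α ⊑ τ) (m : ℕ) → ⌈ coerce p ⌉ · ⌈ ρ m ⌉ ≈βη ⌈_⌉ {n} (ρ m)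
coerce-ρ p m = ρ-extensionality (coerce p) m m λ f x → begin
  ⌈ coerce p ⌉ · ⌈ ρ m ⌉ · f · x
    ≈⟨ β* (v4 · v0 · (v2 · (v3 · v1 · v0) · (v5 · v0))) (x ∷ f ∷ _ ∷ _ ∷ _ ∷ _ ∷ []) ⟩
  ⌈ retract p ⌉ · x · (⌈ ρ m ⌉ · (⌈ conjugate p ⌉ · f · x) · (⌈ up p ⌉ · x))
    ≈⟨ ·-congʳ (ρ-β m _ _) ⟩
  ⌈ retract p ⌉ · x · fold (⌈ up p ⌉ · x) (⌈ conjugate p ⌉ · f · x ·_) m
    ≈⟨ ·-congʳ (fold-up f x m) ⟩
  ⌈ retract p ⌉ · x · (⌈ up p ⌉ · fold x (f ·_) m)
    ≈⟨ retract-up p x _ ⟩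
  fold x (f ·_) m ∎
  where
  fold-up : ∀ {n} (f x : Term n) m →
            fold (⌈ up p ⌉ · x) (⌈ conjugate p ⌉ · f · x ·_) m ≈βη ⌈ up p ⌉ · fold x (f ·_) m
  fold-up f x zero    = ≈-refl
  fold-up f x (suc m) = ≈-trans (·-congʳ (fold-up f x m)) (conjugate-up p f x _)

-- Raising the type of bounded numerals

-- The condition keeps the type `ω o` for branches of any type, because the choice is made pointwise
-- until the branches have type `o`.
if-zero : Ty → Term 0
if-zero o       = ƛ* 3 (v2 · (𝐊 · v0) · v1)
if-zero (σ ⇒ τ) = ƛ* 5 (v4 · v3 · (v2 · v0) · (v1 · v0)) · if-zero τ

⊢if-zero : ∀ τ → [] ⊢ if-zero τ ∶ ω o ⇒ τ ⇒ τ ⇒ τ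
⊢if-zero o       = ⊢ƛ (⊢ƛ (⊢ƛ (⊢· (⊢· (⊢var _) (⊢· (⊢ƛ (⊢ƛ (⊢var _))) (⊢var _))) (⊢var _))))
⊢if-zero (σ ⇒ τ) = ⊢· (⊢ƛ (⊢ƛ (⊢ƛ (⊢ƛ (⊢ƛ (⊢· (⊢· (⊢· (⊢var _) (⊢var _)) (⊢· (⊢var _) (⊢var _))) (⊢· (⊢var _) (⊢var _)))))))) (⊢if-zero τ)

if-zero-⇒ : ∀ σ τ m (t u : Term n) →
  rename suc (⌈ if-zero (σ ⇒ τ) ⌉ · ⌈ ρ m ⌉ · t · u) · v0 ≈βη
  ⌈ if-zero τ ⌉ · ⌈ ρ m ⌉ · (rename suc t · v0) · (rename suc u · v0)
if-zero-⇒ σ τ m t u = ≈-trans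
  (≈-reflexive (cong₂ (λ a b → a · b · rename suc t · rename suc u · v0)
    (rename-⌈⌉ suc (if-zero (σ ⇒ τ))) (rename-⌈⌉ suc (ρ m))))
  (β* (v4 · v3 · (v2 · v0) · (v1 · v0)) (v0 ∷ _ ∷ _ ∷ _ ∷ _ ∷ []))

if-zero-zero : ∀ τ (t u : Term n) → ⌈ if-zero τ ⌉ · ⌈ ρ 0 ⌉ · t · u ≈βη t
if-zero-zero o       t u = ≈-trans (β* (v2 · (𝐊 · v0) · v1) (u ∷ t ∷ _ ∷ [])) (ρ-β 0 _ t)
if-zero-zero (σ ⇒ τ) t u = extensionality (≈-trans (if-zero-⇒ σ τ 0 t u) (if-zero-zero τ _ _))

if-zero-suc : ∀ τ m (t u : Term n) → ⌈ if-zero τ ⌉ · ⌈ ρ (suc m) ⌉ · t · u ≈βη u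
if-zero-suc o       m t u = ≈-trans (β* (v2 · (𝐊 · v0) · v1) (u ∷ t ∷ _ ∷ [])) (≈-trans (ρ-β (suc m) _ t) (𝐊-β u _))
if-zero-suc (σ ⇒ τ) m t u = extensionality (≈-trans (if-zero-⇒ σ τ (suc m) t u) (if-zero-suc τ m _ _))

-- The iterated state waits for the function to be applied next. A step feeds `f` to the old state
-- and leaves the outermost application open.
pred-step : Term n
pred-step = ƛ (ƛ (ƛ (v0 · (v1 · v2))))

-- The start `𝐊 · x` discards the first `f` it receives, which loses one application; the identity
-- closes the one left open at the end.
pred : Term 0
pred = ƛ* 3 (v2 · (pred-step · v1) · (𝐊 · v0) · ƛ v0)

⊢pred : [] ⊢ pred ∶ ω ((π ⇒ π) ⇒ π) ⇒ ω π
⊢pred = ⊢ƛ (⊢ƛ (⊢ƛ (⊢· (⊢· (⊢· (⊢var _)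
  (⊢· (⊢ƛ (⊢ƛ (⊢ƛ (⊢· (⊢var _) (⊢· (⊢var _) (⊢var _)))))) (⊢var _)))
  (⊢· (⊢ƛ (⊢ƛ (⊢var _))) (⊢var _))) (⊢ƛ (⊢var _)))))

pred-ρ : ∀ m → ⌈ pred ⌉ · ⌈ ρ (suc m) ⌉ ≈βη ⌈_⌉ {n} (ρ m)
pred-ρ m = ρ-extensionality pred (suc m) m λ f x → begin
  ⌈ pred ⌉ · ⌈ ρ (suc m) ⌉ · f · x
    ≈⟨ β* (v2 · (pred-step · v1) · (𝐊 · v0) · ƛ v0) (x ∷ f ∷ _ ∷ []) ⟩
  ⌈ ρ (suc m) ⌉ · (pred-step · f) · (𝐊 · x) · ƛ v0
    ≈⟨ ·-congˡ (ρ-β (suc m) _ _) ⟩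
  fold (𝐊 · x) (pred-step · f ·_) (suc m) · ƛ v0
    ≈⟨ fold-step f x (ƛ v0) m ⟩
  ƛ v0 · fold x (f ·_) m
    ≈⟨ β* v0 (_ ∷ []) ⟩
  fold x (f ·_) m ∎
  where
  step-β : ∀ {n} (f g h : Term n) → pred-step · f · g · h ≈βη h · (g · f)
  step-β f g h = β* (v0 · (v1 · v2)) (h ∷ g ∷ f ∷ [])
  -- Stated for arbitrary `h` because the inductive step uses the instance where `h` is `f`.
  fold-step : ∀ {n} (f x h : Term n) m →
              fold (𝐊 · x) (pred-step · f ·_) (suc m) · h ≈βη h · fold x (f ·_) m
  fold-step f x h zero    = ≈-trans (step-β f _ h) (·-congʳ (𝐊-β x f))
  fold-step f x h (suc m) = ≈-trans (step-β f _ h) (·-congʳ (fold-step f x f m))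

-- Each `pred` costs one level of this tower, so a numeral at level `M` admits `M` successive
-- predecessors.
pred-type : ℕ → Ty
pred-type zero    = o
pred-type (suc M) = (pred-type M ⇒ pred-type M) ⇒ pred-type M

-- Primitive recursion unrolled `M` times: `x` at zero, otherwise `f` of the value at the
-- predecessor. The numeral is only tested and decremented, never applied to `f`, which leaves `τ`
-- free. At bound 0 the answer is always `x`.
raise : ℕ → Ty → Term 0
raise zero    τ = ƛ* 3 v0
raise (suc M) τ =
  ƛ* 7 (v6 · (v5 · v2) · v0 · (v1 · (v4 · (v3 · v2) · v1 · v0)))
    · if-zero τ · coerce (o⊑ (pred-type (suc M))) · raise M τ · pred

⊢raise : ∀ M τ → [] ⊢ raise M τ ∶ ω (pred-type M) ⇒ ω τ
⊢raise zero    τ = ⊢ƛ (⊢ƛ (⊢ƛ (⊢var _)))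
⊢raise (suc M) τ = ⊢· (⊢· (⊢· (⊢· (⊢ƛ (⊢ƛ (⊢ƛ (⊢ƛ (⊢ƛ (⊢ƛ (⊢ƛ (⊢· (⊢· (⊢· (⊢var _) (⊢· (⊢var _) (⊢var _))) (⊢var _))
  (⊢· (⊢var _) (⊢· (⊢· (⊢· (⊢var _) (⊢· (⊢var _) (⊢var _))) (⊢var _)) (⊢var _))))))))))) (⊢if-zero τ))
  (⊢coerce (o⊑ (pred-type (suc M))))) (⊢raise M τ)) ⊢pred

raise-ρ : ∀ M τ {m} → m ≤ M → ⌈ raise M τ ⌉ · ⌈ ρ m ⌉ ≈βη ⌈_⌉ {n} (ρ m)
raise-ρ zero    τ z≤n = ρ-extensionality (raise 0 τ) 0 0 λ f x → β* v0 (x ∷ f ∷ _ ∷ [])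
raise-ρ (suc M) τ {m} m≤1+M = ρ-extensionality (raise (suc M) τ) m m λ f x → begin
  ⌈ raise (suc M) τ ⌉ · ⌈ ρ m ⌉ · f · x
    ≈⟨ β* (v6 · (v5 · v2) · v0 · (v1 · (v4 · (v3 · v2) · v1 · v0))) (x ∷ f ∷ _ ∷ _ ∷ _ ∷ _ ∷ _ ∷ []) ⟩
  ⌈ if-zero τ ⌉ · (⌈ coerce o⊑π ⌉ · ⌈ ρ m ⌉) · x · (f · (⌈ raise M τ ⌉ · (⌈ pred ⌉ · ⌈ ρ m ⌉) · f · x))
    ≈⟨ ·-congˡ (·-congˡ (·-congʳ (coerce-ρ o⊑π m))) ⟩
  ⌈ if-zero τ ⌉ · ⌈ ρ m ⌉ · x · (f · (⌈ raise M τ ⌉ · (⌈ pred ⌉ · ⌈ ρ m ⌉) · f · x))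
    ≈⟨ branch f x m≤1+M ⟩
  fold x (f ·_) m ∎
  where
  o⊑π = o⊑ (pred-type (suc M))
  branch : ∀ {n m} (f x : Term n) → m ≤ suc M →
    ⌈ if-zero τ ⌉ · ⌈ ρ m ⌉ · x · (f · (⌈ raise M τ ⌉ · (⌈ pred ⌉ · ⌈ ρ m ⌉) · f · x)) ≈βη fold x (f ·_) m
  -- The test discards the branch that holds the predecessor of 0.
  branch f x z≤n               = if-zero-zero τ x _
  branch f x (s≤s {m = m} m≤M) = begin
    ⌈ if-zero τ ⌉ · ⌈ ρ (suc m) ⌉ · x · (f · (⌈ raise M τ ⌉ · (⌈ pred ⌉ · ⌈ ρ (suc m) ⌉) · f · x))
      ≈⟨ if-zero-suc τ m x _ ⟩
    f · (⌈ raise M τ ⌉ · (⌈ pred ⌉ · ⌈ ρ (suc m) ⌉) · f · x)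
      ≈⟨ ·-congʳ (·-congˡ (·-congˡ (·-congʳ (pred-ρ m)))) ⟩
    f · (⌈ raise M τ ⌉ · ⌈ ρ m ⌉ · f · x)
      ≈⟨ ·-congʳ (·-congˡ (·-congˡ (raise-ρ M τ m≤M))) ⟩
    f · (⌈ ρ m ⌉ · f · x)
      ≈⟨ ·-congʳ (ρ-β m f x) ⟩
    f · fold x (f ·_) m ∎

-- Type instantiation

inst : Ty → Ty → Ty
inst π o       = π
inst π (σ ⇒ τ) = inst π σ ⇒ inst π τ

⊢inst : ∀ π {Γ : Vec Ty n} {t} → Γ ⊢ t ∶ τ → map (inst π) Γ ⊢ t ∶ inst π τ
⊢inst π {Γ} (⊢var i) = ≡.subst (_ ⊢ var i ∶_) (lookup-map i (inst π) Γ) (⊢var i)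
⊢inst π (⊢ƛ d)       = ⊢ƛ (⊢inst π d)
⊢inst π (⊢· d e)     = ⊢· (⊢inst π d) (⊢inst π e)

inst-⇛ : ∀ π (αs : Vec Ty k) β → inst π (map ω αs ⇛ β) ≡ map ω (map (inst π) αs) ⇛ inst π β
inst-⇛ π []       β = refl
inst-⇛ π (α ∷ αs) β = cong (_ ⇒_) (inst-⇛ π αs β)

-- Replacing the final `o` of `β` puts the arguments of `π` at the end of the list, so it suffices
-- to drop all those before them.
⊑-inst : ∀ π β → π ⊑ inst π β
⊑-inst π o       = ⊑-refl π
⊑-inst π (σ ⇒ β) = drop (inst π σ) (⊑-inst π β)

numeralType-ω : IsNumeralType α → ∃[ τ ] α ≡ ω τ
-- 2 is the least numeral that forces source and target of `f` to agree: `ρ 1` also has the types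
-- `(σ ⇒ τ) ⇒ σ ⇒ τ`.
numeralType-ω p with p 2
... | ⊢ƛ (⊢ƛ (⊢· (⊢var _) (⊢· (⊢var _) (⊢var _)))) = _ , refl

numeralTypes-ω : {αs : Vec Ty k} → All IsNumeralType αs → ∃[ τs ] αs ≡ map ω τs
numeralTypes-ω []       = [] , refl
numeralTypes-ω (p ∷ ps) with numeralType-ω p | numeralTypes-ω ps
... | τ , refl | τs , refl = τ ∷ τs , refl

-- Composition with coercions

-- The function to be adapted is an argument of the resulting term, since the recursion hands it on
-- already applied to its coerced first argument.
adapt : {αs : Vec Ty k} → All (_⊑ τ) αs → Term 0 → Term 0
adapt []       u = u
adapt (p ∷ ps) u = ƛ* 4 (v3 · (v1 · (v2 · v0))) · adapt ps u · coerce p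

⊢adapt : {αs : Vec Ty k} (ps : All (_⊑ τ) αs) {u : Term 0} → [] ⊢ u ∶ β ⇒ σ →
         [] ⊢ adapt ps u ∶ (map ω αs ⇛ β) ⇒ (replicate k (ω τ) ⇛ σ)
⊢adapt []       d = d
⊢adapt (p ∷ ps) d = ⊢· (⊢· (⊢ƛ (⊢ƛ (⊢ƛ (⊢ƛ (⊢· (⊢var _) (⊢· (⊢var _) (⊢· (⊢var _) (⊢var _)))))))) (⊢adapt ps d)) (⊢coerce p)

adapt-ρ : {αs : Vec Ty k} (ps : All (_⊑ τ) αs) (u t : Term 0) (ns : Vec ℕ k) →
          (⌈ adapt ps u ⌉ · t) ·* map ρ ns ≈βη ⌈ u ⌉ · (t ·* map ρ ns)
adapt-ρ []       u t []       = ≈-refl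
adapt-ρ (p ∷ ps) u t (n ∷ ns) = begin
  (⌈ adapt (p ∷ ps) u ⌉ · t · ρ n) ·* map ρ ns
    ≈⟨ ·*-congˡ (map ρ ns) (β* (v3 · (v1 · (v2 · v0))) (ρ n ∷ t ∷ _ ∷ _ ∷ [])) ⟩
  (⌈ adapt ps u ⌉ · (t · (⌈ coerce p ⌉ · ρ n))) ·* map ρ ns
    ≈⟨ adapt-ρ ps u _ ns ⟩
  ⌈ u ⌉ · ((t · (⌈ coerce p ⌉ · ρ n)) ·* map ρ ns)
    ≈⟨ ·-congʳ (·*-congˡ (map ρ ns) (·-congʳ coerce-ρ₀)) ⟩
  ⌈ u ⌉ · ((t · ρ n) ·* map ρ ns) ∎
  where
  coerce-ρ₀ : ⌈ coerce p ⌉ · ρ n ≈βη ρ n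
  coerce-ρ₀ = ≡.subst (λ r → ⌈ coerce p ⌉ · r ≈βη r) (⌈⌉-id (ρ n)) (coerce-ρ p n)

theorem4 : ∀ (k : ℕ) (f : Vec ℕ k → ℕ) → SkewlyRepresentable f → FiniteRange f → StrictlyRepresentable f
theorem4 k f (E , _ , _ , αs-num , β-num , ⊢E , E-rep) (xs , f∈xs)
  with numeralTypes-ω αs-num | numeralType-ω β-num
-- The bound is taken over the argument types after instantiation. The result type need not lie
-- below it, as `raise` reaches any `τ`.
... | αs , refl | β , refl with upper-bound (map (inst (pred-type (max 0 xs))) αs)
... | τ , αs⊑τ = adapt αs⊑τ post · E , τ , ⊢· (⊢adapt αs⊑τ ⊢post) ⊢E′ , rep
  where
  -- The 0 is the default for an empty list; otherwise `M` is the largest listed value.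
  M  = max 0 xs
  π′ = pred-type M
  -- Results go down from `inst π′ β` to `π′`, where `M` predecessors are available, and from there
  -- to `τ`.
  post : Term 0
  post = ƛ* 3 (v2 · (v1 · v0)) · raise M τ · coerce (⊑-inst π′ β)
  ⊢post : [] ⊢ post ∶ ω (inst π′ β) ⇒ ω τ
  ⊢post = ⊢· (⊢· (⊢ƛ (⊢ƛ (⊢ƛ (⊢· (⊢var _) (⊢· (⊢var _) (⊢var _)))))) (⊢raise M τ)) (⊢coerce (⊑-inst π′ β))
  ⊢E′ : [] ⊢ E ∶ map ω (map (inst π′) αs) ⇛ ω (inst π′ β)
  ⊢E′ = ≡.subst ([] ⊢ E ∶_) (inst-⇛ π′ αs (ω β)) (⊢inst π′ ⊢E)
  post-ρ : ∀ {m} → m ≤ M → ⌈ post ⌉ · ⌈ ρ m ⌉ ≈βη ⌈_⌉ {0} (ρ m)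
  post-ρ {m} m≤M = begin
    ⌈ post ⌉ · ⌈ ρ m ⌉                                      ≈⟨ β* (v2 · (v1 · v0)) (_ ∷ _ ∷ _ ∷ []) ⟩
    ⌈ raise M τ ⌉ · (⌈ coerce (⊑-inst π′ β) ⌉ · ⌈ ρ m ⌉)    ≈⟨ ·-congʳ (coerce-ρ (⊑-inst π′ β) m) ⟩
    ⌈ raise M τ ⌉ · ⌈ ρ m ⌉                                 ≈⟨ raise-ρ M τ m≤M ⟩
    ⌈ ρ m ⌉                                                 ∎
  rep : Represents (adapt αs⊑τ post · E) f
  rep ns = begin
    (adapt αs⊑τ post · E) ·* map ρ ns      ≡⟨ cong (λ a → (a · E) ·* map ρ ns) (⌈⌉-id (adapt αs⊑τ post)) ⟨
    (⌈ adapt αs⊑τ post ⌉ · E) ·* map ρ ns  ≈⟨ adapt-ρ αs⊑τ post E ns ⟩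
    ⌈ post ⌉ · (E ·* map ρ ns)             ≈⟨ ·-congʳ (E-rep ns) ⟩
    ⌈ post ⌉ · ρ (f ns)                    ≡⟨ cong (⌈ post ⌉ ·_) (⌈⌉-id (ρ (f ns))) ⟨
    ⌈ post ⌉ · ⌈ ρ (f ns) ⌉                ≈⟨ post-ρ (ListAll.lookup (xs≤max 0 xs) (f∈xs ns)) ⟩
    ⌈ ρ (f ns) ⌉                           ≡⟨ ⌈⌉-id (ρ (f ns)) ⟩
    ρ (f ns)                               ∎
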